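{- The originally published Shoshan-Zwick algorithm (defined in the context) is incorrect: it does not always return the matrix of shortest path costs of an undirected graph with integer edge costs in $\{1,\dots,M\}$. Specifically, let $G'$ be the undirected graph on three vertices $a,b,c$ (numbered $1,2,3$) with exactly two edges, $(a,b)$ of cost $2$ and $(a,c)$ of cost $4$, and let $M=4$, so that the input is $$\mathbf D=\begin{bmatrix}0&2&4\\2&0&+\infty\\4&+\infty&0\end{bmatrix}.$$ On this input the algorithm returns $$\Delta=\begin{bmatrix}4&6&0\\6&4&-2\\0&-2&4\end{bmatrix},$$ whereas the matrix of shortest path costs of $G'$ is $$\begin{bmatrix}0&2&4\\2&0&6\\4&6&0\end{bmatrix}.$$
   Context: All matrices are $n\times n$ with entries in $\mathbb Z\cup\{+\infty\}$, with the usual conventions: $+\infty$ plus or minus an integer is $+\infty$, $+\infty+\infty=+\infty$, and $+\infty$ is larger than every integer (so $+\infty\ge 0$ holds). A graph on $\{1,\dots,n\}$ with edge costs in $\{1,\dots,M\}$, $M=2^m$, $m\ge1$, is represented by its matrix $\mathbf D=(d_{ij})$, where $d_{ij}$ is the cost of edge $(i,j)$ if it exists, $d_{ii}=0$, and $d_{ij}=+\infty$ otherwise. Operations (for matrices $\mathbf A=(a_{ij})$, $\mathbf B=(b_{ij})$ and integers $a\le b$): - Distance product: $(\mathbf A\star\mathbf B)_{ij}=\min_{1\le k\le n}\{a_{ik}+b_{kj}\}$. - $(\mathrm{clip}(\mathbf A,a,b))_{ij}=a$ if $a_{ij}<a$; $=a_{ij}$ if $a\le a_{ij}\le b$; $=+\infty$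 if $a_{ij}>b$. - $(\mathrm{chop}(\mathbf A,a,b))_{ij}=a_{ij}$ if $a\le a_{ij}\le b$; $=+\infty$ otherwise. - $(\mathbf A\bigwedge\mathbf B)_{ij}=a_{ij}$ if $b_{ij}<0$; $=+\infty$ otherwise. - $(\mathbf A\bar{\bigwedge}\mathbf B)_{ij}=a_{ij}$ if $b_{ij}\ge 0$; $=+\infty$ otherwise. - $(\mathbf A\bigvee\mathbf B)_{ij}=a_{ij}$ if $a_{ij}\ne+\infty$; $=b_{ij}$ if $a_{ij}=+\infty$. - For a condition on entries, such as $(\mathbf C\ge 0)$ or $(0\le\mathbf P<M)$, the corresponding Boolean matrix has $(i,j)$ entry $1$ if the $(i,j)$ entry of the matrix satisfies the condition and $0$ otherwise. - $\mathbf D-M$ denotes subtracting $M$ from each entry; "$\mathbf C=-M$" and "$\mathbf Q=+\infty$" denote constant matrices. $\mathbf P\bmod M$ is taken entrywise, where the remainder has the sign of the dividend (truncated division; e.g. $-2\bmod 4=-2$). Original Shoshan-Zwick algorithm on input $\mathbf D$ (with $M=2^m$): 1. Set $l=\lceil\log_2 n\rceil$ and $m=\log_2 M$. 2. Repeat $m+1$ times: $\mathbf D:=\mathrm{clip}(\mathbf D\star\mathbf D,0,2M)$. 3. $\mathbf A_0:=\mathbf D-M$. For $k=1,\dots,l$: $\mathbf A_k:=\mathrm{clip}(\mathbf A_{k-1}\star\mathbf A_{k-1},-M,M)$. 4. $\mathbf C_l:=-M$; $\mathbf P_l:=\mathrm{clip}(\mathbf D,0,M)$; $\mathbf Q_l:=+\infty$.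 5. For $k=l-1$ down to $0$: $\mathbf C_k:=[\mathrm{clip}(\mathbf P_{k+1}\star\mathbf A_k,-M,M)\bigwedge\mathbf C_{k+1}]\bigvee[\mathrm{clip}(\mathbf Q_{k+1}\star\mathbf A_k,-M,M)\bar{\bigwedge}\mathbf C_{k+1}]$; $\mathbf P_k:=\mathbf P_{k+1}\bigvee\mathbf Q_{k+1}$; $\mathbf Q_k:=\mathrm{chop}(\mathbf C_k,1-M,M)$. 6. For $k=1,\dots,l$: $\mathbf B_k:=(\mathbf C_k\ge 0)$. 7. $\mathbf B_0:=(0\le\mathbf P_0<M)$; $\mathbf R:=\mathbf P_0\bmod M$. 8. Return $\Delta:=M\cdot\sum_{k=0}^{l}2^k\cdot\mathbf B_k+\mathbf R$. -}

module Defs where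

open import Data.Bool using (Bool; true; false; if_then_else_; _∧_; not)
open import Data.Fin using (Fin; _≟_)
open import Data.Fin.Patterns using (0F; 1F; 2F)
open import Data.Integer as ℤ using (ℤ; +_; -_; 0ℤ; 1ℤ)
import Data.Integer.Properties as ℤ
open import Data.List using (map; upTo)
open import Data.Maybe using (Maybe; just; nothing)
open import Data.Nat as ℕ using (ℕ; zero; suc; _^_; _∸_; NonZero; z≤n; s≤s)
open import Data.Nat.GeneralisedArithmetic using (fold)
open import Data.Nat.ListAction using (sum)
open import Data.Nat.Logarithm using (⌈log₂_⌉)
open import Data.Nat.Properties using (m^n≢0)
open import Data.Product using (Σ-syntax; ∃-syntax; _×_; _,_)
open import Data.Vec using (Vec; tabulate; lookup; foldr′)
open import Relation.Binary.Construct.Add.Supremum.NonStrict ℤ._≤_ using (_≤⁺_; ≤⁺-dec)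
open import Relation.Binary.Construct.Add.Supremum.Strict ℤ._<_ using (_<⁺_; <⁺-dec)
open import Relation.Binary.Definitions using (Decidable)
open import Relation.Binary.PropositionalEquality using (_≡_; refl)
open import Relation.Nullary using (¬_; does)
open import Relation.Nullary.Construct.Add.Supremum using (_⁺; [_]; ⊤⁺)

private
  variable
    n : ℕ
    A : Set

ℤ∞ : Set
ℤ∞ = ℤ ⁺

pattern ∞ = ⊤⁺

infix  4 _≤?_ _<?_
infixl 6 _⊕_ _⊖_
infixl 7 _⊓_ _mod_

_≤?_ : Decidable _≤⁺_
_≤?_ = ≤⁺-dec ℤ._≤?_

_<?_ : Decidable _<⁺_
_<?_ = <⁺-dec ℤ._<?_

_⊕_ : ℤ∞ → ℤ∞ → ℤ∞
[ x ] ⊕ [ y ] = [ x ℤ.+ y ]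
[ _ ] ⊕ ∞     = ∞
∞     ⊕ _     = ∞

_⊓_ : ℤ∞ → ℤ∞ → ℤ∞
x ⊓ y = if does (x ≤? y) then x else y

-- Truncated division: the remainder has the sign of the dividend.  This is
-- neither of the (non-negative) remainders of Data.Integer.DivMod.
-- The remainder of +∞ is taken to be +∞.
_mod_ : ℤ∞ → (M : ℕ) → .{{NonZero M}} → ℤ∞
[ x ] mod M = [ ℤ.sign x ℤ.◃ (ℤ.∣ x ∣ ℕ.% M) ]
∞     mod M = ∞

Matrix : Set → ℕ → Set
Matrix A n = Vec (Vec A n) n

matrix : (Fin n → Fin n → A) → Matrix A n
matrix f = tabulate λ i → tabulate λ j → f i j

infix 8 _⟨_,_⟩

_⟨_,_⟩ : Matrix A n → Fin n → Fin n → A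
X ⟨ i , j ⟩ = lookup (lookup X i) j

constant : ℤ∞ → Matrix ℤ∞ n
constant x = matrix λ _ _ → x

infixl 7 _⋆_
infixl 6 _⋀_ _⋀̄_
infixl 5 _⋁_

_⋆_ : Matrix ℤ∞ n → Matrix ℤ∞ n → Matrix ℤ∞ n
X ⋆ Y = matrix λ i j →
  foldr′ _⊓_ ∞ (tabulate λ k → X ⟨ i , k ⟩ ⊕ Y ⟨ k , j ⟩)

clip : Matrix ℤ∞ n → ℤ → ℤ → Matrix ℤ∞ n
clip X a b = matrix λ i j → let x = X ⟨ i , j ⟩ in
  if does (x <? [ a ]) then [ a ] else
  if does (x ≤? [ b ]) then x else ∞

chop : Matrix ℤ∞ n → ℤ → ℤ → Matrix ℤ∞ n
chop X a b = matrix λ i j → let x = X ⟨ i , j ⟩ in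
  if does ([ a ] ≤? x) ∧ does (x ≤? [ b ]) then x else ∞

_⋀_ : Matrix ℤ∞ n → Matrix ℤ∞ n → Matrix ℤ∞ n
X ⋀ Y = matrix λ i j → if does (Y ⟨ i , j ⟩ <? [ 0ℤ ]) then X ⟨ i , j ⟩ else ∞

_⋀̄_ : Matrix ℤ∞ n → Matrix ℤ∞ n → Matrix ℤ∞ n
X ⋀̄ Y = matrix λ i j → if does ([ 0ℤ ] ≤? Y ⟨ i , j ⟩) then X ⟨ i , j ⟩ else ∞

_⋁_ : Matrix ℤ∞ n → Matrix ℤ∞ n → Matrix ℤ∞ n
X ⋁ Y = matrix λ i j → orElse (X ⟨ i , j ⟩) (Y ⟨ i , j ⟩)
  where
  orElse : ℤ∞ → ℤ∞ → ℤ∞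
  orElse [ x ] _ = [ x ]
  orElse ∞     y = y

_⊖_ : Matrix ℤ∞ n → ℤ → Matrix ℤ∞ n
X ⊖ a = matrix λ i j → X ⟨ i , j ⟩ ⊕ [ - a ]

bit : Bool → ℕ
bit true  = 1
bit false = 0

-- The original algorithm, for costs in {1, …, 2 ^ m}, on the input D.
module ShoshanZwick (m : ℕ) {n : ℕ} (D : Matrix ℤ∞ n) where

  M : ℕ
  M = 2 ^ m

  instance
    M≢0 : NonZero M
    M≢0 = m^n≢0 2 m

  l : ℕ
  l = ⌈log₂ n ⌉

  -- The value of D after the initial m + 1 squarings.
  D₁ : Matrix ℤ∞ n
  D₁ = fold D (λ X → clip (X ⋆ X) 0ℤ (+ (2 ℕ.* M))) (m ℕ.+ 1)

  𝐀 : ℕ → Matrix ℤ∞ n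
  𝐀 zero    = D₁ ⊖ (+ M)
  𝐀 (suc k) = clip (𝐀 k ⋆ 𝐀 k) (- + M) (+ M)

  record State : Set where
    constructor state
    field
      C P Q : Matrix ℤ∞ n

  initial : State
  initial = state (constant [ - + M ]) (clip D₁ 0ℤ (+ M)) (constant ∞)

  -- From (C_{k+1}, P_{k+1}, Q_{k+1}) to (C_k, P_k, Q_k).
  step : ℕ → State → State
  step k (state C P Q) = state C′ (P ⋁ Q) (chop C′ (1ℤ ℤ.- + M) (+ M))
    where
    C′ : Matrix ℤ∞ n
    C′ = (clip (P ⋆ 𝐀 k) (- + M) (+ M) ⋀ C) ⋁ (clip (Q ⋆ 𝐀 k) (- + M) (+ M) ⋀̄ C)

  -- afterSteps t is (C_{l-t}, P_{l-t}, Q_{l-t}), for t ≤ l.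
  afterSteps : ℕ → State
  afterSteps zero    = initial
  afterSteps (suc t) = step (l ∸ suc t) (afterSteps t)

  𝐂 𝐏 : ℕ → Matrix ℤ∞ n
  𝐂 k = State.C (afterSteps (l ∸ k))
  𝐏 k = State.P (afterSteps (l ∸ k))

  𝐁 : ℕ → Matrix Bool n
  𝐁 zero      = matrix λ i j →
    does ([ 0ℤ ] ≤? 𝐏 0 ⟨ i , j ⟩) ∧ does (𝐏 0 ⟨ i , j ⟩ <? [ + M ])
  𝐁 k@(suc _) = matrix λ i j → does ([ 0ℤ ] ≤? 𝐂 k ⟨ i , j ⟩)

  𝐑 : Matrix ℤ∞ n
  𝐑 = matrix λ i j → 𝐏 0 ⟨ i , j ⟩ mod M

  Δ : Matrix ℤ∞ n
  Δ = matrix λ i j →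
    [ + (M ℕ.* sum (map (λ k → 2 ^ k ℕ.* bit (𝐁 k ⟨ i , j ⟩)) (upTo (suc l)))) ]
    ⊕ 𝐑 ⟨ i , j ⟩

shoshanZwick : (m : ℕ) → Matrix ℤ∞ n → Matrix ℤ∞ n
shoshanZwick m D = ShoshanZwick.Δ m D

-- Finite simple undirected graphs on n vertices with edge costs in {1, …, M};
-- cost i j is nothing when (i, j) is not an edge.
record Graph (n M : ℕ) : Set where
  field
    cost       : Fin n → Fin n → Maybe ℕ
    undirected : ∀ i j → cost i j ≡ cost j i
    loopless   : ∀ i → cost i i ≡ nothing
    bounded    : ∀ i j {c} → cost i j ≡ just c → 1 ℕ.≤ c × c ℕ.≤ M

open Graph public

private
  variable
    M : ℕ

costMatrix : Graph n M → Matrix ℤ∞ n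
costMatrix G = matrix λ i j → if does (i ≟ j) then [ 0ℤ ] else edge (cost G i j)
  where
  edge : Maybe ℕ → ℤ∞
  edge (just c) = [ + c ]
  edge nothing  = ∞

infixr 5 _∷_

-- Vertices may be repeated; the empty path joins a vertex to itself.
data Path (G : Graph n M) : Fin n → Fin n → Set where
  []  : ∀ {i} → Path G i i
  _∷_ : ∀ {i j k c} → cost G i j ≡ just c → Path G j k → Path G i k

pathCost : {G : Graph n M} {i j : Fin n} → Path G i j → ℕ
pathCost []                = 0
pathCost (_∷_ {c = c} _ p) = c ℕ.+ pathCost p

IsShortestPathCost : (G : Graph n M) → Fin n → Fin n → ℤ∞ → Set
IsShortestPathCost G i j [ d ] =
  (Σ[ p ∈ Path G i j ] + pathCost p ≡ d) × (∀ (p : Path G i j) → d ℤ.≤ + pathCost p)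
IsShortestPathCost G i j ∞     = ¬ Path G i j

IsShortestPathMatrix : (G : Graph n M) → Matrix ℤ∞ n → Set
IsShortestPathMatrix G X = ∀ i j → IsShortestPathCost G i j (X ⟨ i , j ⟩)

-- The vertices a, b, c are 0F, 1F, 2F.
G′ : Graph 3 4
G′ = record
  { cost       = cost′
  ; undirected = λ { 0F 0F → refl ; 0F 1F → refl ; 0F 2F → refl
                   ; 1F 0F → refl ; 1F 1F → refl ; 1F 2F → refl
                   ; 2F 0F → refl ; 2F 1F → refl ; 2F 2F → refl }
  ; loopless   = λ { 0F → refl ; 1F → refl ; 2F → refl }
  ; bounded    = λ { 0F 1F refl → s≤s z≤n , s≤s (s≤s z≤n)
                   ; 1F 0F refl → s≤s z≤n , s≤s (s≤s z≤n)
                   ; 0F 2F refl → s≤s z≤n , s≤s (s≤s (s≤s (s≤s z≤n)))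
                   ; 2F 0F refl → s≤s z≤n , s≤s (s≤s (s≤s (s≤s z≤n)))
                   ; 0F 0F () ; 1F 1F () ; 1F 2F () ; 2F 1F () ; 2F 2F () }
  }
  where
  cost′ : Fin 3 → Fin 3 → Maybe ℕ
  cost′ 0F 1F = just 2
  cost′ 1F 0F = just 2
  cost′ 0F 2F = just 4
  cost′ 2F 0F = just 4
  cost′ _  _  = nothing

{-# OPTIONS --safe #-}
module Submission where

-- The algorithm is evaluated on G′; its (b, c) entry is −2, which is not the
-- cost of any path.  The true costs are attained by explicit paths, and they
-- are minimal because, for a fixed target, their costs form a feasible
-- potential: they drop by at most c along an edge of cost c.

open import Data.Fin using (Fin)
open import Data.Fin.Patterns using (0F; 1F; 2F)
open import Data.Fin.Properties using (all?)
open import Data.Integer using (+_; -_; +≤+)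
open import Data.Maybe using (just)
open import Data.Nat using (ℕ; _≤_; _^_; _+_; z≤n; s≤s; _≤?_)
open import Data.Nat.Properties using (≤-reflexive; +-monoʳ-≤; module ≤-Reasoning)
open import Data.Product using (_×_; _,_)
open import Data.Vec using ([]; _∷_; tabulate)
open import Data.Vec.Properties using (lookup∘tabulate)
open import Relation.Binary.PropositionalEquality using (_≡_; refl; subst)
open import Relation.Nullary using (¬_)
open import Relation.Nullary.Construct.Add.Supremum using ([_])
open import Relation.Nullary.Decidable using (from-yes)
open import Defs using (∞; Graph; G′; costMatrix; shoshanZwick; IsShortestPathMatrix)
open import Defs using (Matrix; ℤ∞; matrix; cost; Path; []; _∷_; pathCost; IsShortestPathCost)

module _ {n M : ℕ} {G : Graph n M} where

  -- At variable indices `lookup` is stuck on `tabulate`, so the entry has to be rewritten to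
  -- `f i j`, first for the row and then within it.
  isShortestPathMatrix-matrix : {f : Fin n → Fin n → ℤ∞} →
    (∀ i j → IsShortestPathCost G i j (f i j)) → IsShortestPathMatrix G (matrix f)
  isShortestPathMatrix-matrix {f} shortest i j
    rewrite lookup∘tabulate (λ i → tabulate (f i)) i
          | lookup∘tabulate (f i) j
    = shortest i j

  module _ (geodesic : ∀ i j → Path G i j)
           (loop : ∀ i → pathCost (geodesic i i) ≡ 0)
           (triangle : ∀ i j {c} → cost G i j ≡ just c → ∀ k →
                       pathCost (geodesic i k) ≤ c + pathCost (geodesic j k))
           where

    -- Induction on the path with its target fixed: `loop` makes the potential vanish at the target,
    -- and `triangle` pays for the first edge.
    geodesic-minimal : ∀ {i j} (p : Path G i j) → pathCost (geodesic i j) ≤ pathCost p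
    geodesic-minimal {i} [] = ≤-reflexive (loop i)
    geodesic-minimal {i} {k} (_∷_ {j = j} {c = c} e p) = begin
      pathCost (geodesic i k)      ≤⟨ triangle i j e k ⟩
      c + pathCost (geodesic j k)  ≤⟨ +-monoʳ-≤ c (geodesic-minimal p) ⟩
      c + pathCost p               ∎
      where open ≤-Reasoning

    geodesicCosts-shortest :
      IsShortestPathMatrix G (matrix λ i j → [ + pathCost (geodesic i j) ])
    geodesicCosts-shortest = isShortestPathMatrix-matrix λ i j →
      (geodesic i j , refl) , λ p → +≤+ (geodesic-minimal p)

geodesic′ : ∀ i j → Path G′ i j
geodesic′ 0F 0F = []
geodesic′ 0F 1F = refl ∷ []
geodesic′ 0F 2F = refl ∷ []
geodesic′ 1F 0F = refl ∷ []
geodesic′ 1F 1F = []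
-- The only route between b and c without repeated vertices passes through a. Unification cannot
-- recover this middle vertex from the edge costs, so it is supplied.
geodesic′ 1F 2F = _∷_ {j = 0F} refl (refl ∷ [])
geodesic′ 2F 0F = refl ∷ []
geodesic′ 2F 1F = _∷_ {j = 0F} refl (refl ∷ [])
geodesic′ 2F 2F = []

geodesic′-loop : ∀ i → pathCost (geodesic′ i i) ≡ 0
geodesic′-loop 0F = refl
geodesic′-loop 1F = refl
geodesic′-loop 2F = refl

-- Matching the edge equation with `refl` fixes `c`; what remains is a decidable check over the
-- three targets. Non-edges are absurd.
geodesic′-triangle : ∀ i j {c} → cost G′ i j ≡ just c → ∀ k →
  pathCost (geodesic′ i k) ≤ c + pathCost (geodesic′ j k)
geodesic′-triangle 0F 1F refl = from-yes (all? λ k →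
  pathCost (geodesic′ 0F k) ≤? 2 + pathCost (geodesic′ 1F k))
geodesic′-triangle 1F 0F refl = from-yes (all? λ k →
  pathCost (geodesic′ 1F k) ≤? 2 + pathCost (geodesic′ 0F k))
geodesic′-triangle 0F 2F refl = from-yes (all? λ k →
  pathCost (geodesic′ 0F k) ≤? 4 + pathCost (geodesic′ 2F k))
geodesic′-triangle 2F 0F refl = from-yes (all? λ k →
  pathCost (geodesic′ 2F k) ≤? 4 + pathCost (geodesic′ 0F k))
geodesic′-triangle 0F 0F ()
geodesic′-triangle 1F 1F ()
geodesic′-triangle 1F 2F ()
geodesic′-triangle 2F 1F ()
geodesic′-triangle 2F 2F ()

output : Matrix ℤ∞ 3
output =
    ([ + 4 ] ∷ [ + 6 ]     ∷ [ + 0 ]     ∷ [])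
  ∷ ([ + 6 ] ∷ [ + 4 ]     ∷ [ - (+ 2) ] ∷ [])
  ∷ ([ + 0 ] ∷ [ - (+ 2) ] ∷ [ + 4 ]     ∷ [])
  ∷ []

shoshanZwick-G′ : shoshanZwick 2 (costMatrix G′) ≡ output
-- The input is closed, so type checking runs the whole algorithm.
shoshanZwick-G′ = refl

output-incorrect : ¬ IsShortestPathMatrix G′ output
output-incorrect shortest with shortest 1F 2F
-- A path cost is `+ _`, a different constructor of the integers from that of -2.
... | (_ , ()) , _

mainTheorem2 : (¬ (∀ (n m : ℕ) → 1 ≤ n → 1 ≤ m → (G : Graph n (2 ^ m)) →
    IsShortestPathMatrix G (shoshanZwick m (costMatrix G))))
    ×
    (costMatrix G′ ≡
    ([ + 0 ] ∷ [ + 2 ] ∷ [ + 4 ] ∷ [])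
    ∷ ([ + 2 ] ∷ [ + 0 ] ∷ ∞       ∷ [])
    ∷ ([ + 4 ] ∷ ∞       ∷ [ + 0 ] ∷ [])
    ∷ [])
    ×
    (shoshanZwick 2 (costMatrix G′) ≡
    ([ + 4 ] ∷ [ + 6 ]     ∷ [ + 0 ]     ∷ [])
    ∷ ([ + 6 ] ∷ [ + 4 ]     ∷ [ - (+ 2) ] ∷ [])
    ∷ ([ + 0 ] ∷ [ - (+ 2) ] ∷ [ + 4 ]     ∷ [])
    ∷ [])
    ×
    IsShortestPathMatrix G′
    ( ([ + 0 ] ∷ [ + 2 ] ∷ [ + 4 ] ∷ [])
    ∷ ([ + 2 ] ∷ [ + 0 ] ∷ [ + 6 ] ∷ [])
    ∷ ([ + 4 ] ∷ [ + 6 ] ∷ [ + 0 ] ∷ [])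
    ∷ [])
mainTheorem2 =
    (λ correct → output-incorrect (subst (IsShortestPathMatrix G′) shoshanZwick-G′
       -- `m` is 2 because `2 ^ 2` computes to 4, the cost bound of `G′`.
       (correct 3 2 (s≤s z≤n) (s≤s z≤n) G′)))
  , refl
  , shoshanZwick-G′
  -- The matrix of the costs of `geodesic′` normalises to the displayed one.
  , geodesicCosts-shortest geodesic′ geodesic′-loop geodesic′-triangle
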